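{- Let $k\ge 1$ and $1\le k^*\le k$ be integers, and run the Reduce-By-Median-Counter algorithm (defined in the context) with parameters $k,k^*$ on a weighted stream. Then for every integer $0\le j<k^*$ and every item $i\in[m]$, the estimate $\hat f_i$ returned by Estimate$(i)$ after processing the stream satisfies $$0\le f_i-\hat f_i\le \frac{N^{\mathrm{res}(j)}}{k^*-j}.$$
   Context: A weighted stream over the universe $[m]=\{1,\dots,m\}$ is a sequence of updates $(i_1,\Delta_1),\dots,(i_n,\Delta_n)$ with $i_t\in[m]$ and real weights $\Delta_t>0$. The frequency of $i$ is $f_i=\sum_{t: i_t=i}\Delta_t$, and $N=\sum_t\Delta_t$. $N^{\mathrm{res}(j)}$ denotes the sum of the frequencies of all items except the $j$ items of largest frequency (ties broken arbitrarily). The Reduce-By-Median-Counter algorithm with integer parameters $k\ge 1$ and $1\le k^*\le k$ maintains a set $T\subseteq[m]$ of at most $k$ items, each $j\in T$ carrying a nonnegative real counter $c(j)$; initially $T=\emptyset$. Update$(i,\Delta)$: if $i\in T$, set $c(i)\gets c(i)+\Delta$; else if $|T|<k$, add $i$ to $T$ with $c(i)=\Delta$; else call DecrementCounters(), and afterwards, if $\Delta\ge c_{k^*}$, add $i$ to $T$ with $c(i)=\Delta-c_{k^*}$. DecrementCounters(): let $c_{k^*}$ be the $k^*$-th largest value, counting multiplicity, of the multiset $\{c(j): j\in T\}$; for every $j\in T$ set $c(j)\gets c(j)-c_{k^*}$, and remove $j$ from $T$ if now $c(j)\le 0$. Estimate$(i)$ returns $c(i)$ if $i\in T$ and $0$ otherwise.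 -}

module Defs where

open import Data.Fin using (Fin; toℕ)
open import Data.Fin.Properties using () renaming (_≟_ to _≟ᶠ_)
open import Data.Integer using (+_)
import Data.Integer as ℤ
open import Data.List using (List; []; _∷_; map; filter; foldr; length; drop; catMaybes; lookup)
open import Data.List.Relation.Binary.Permutation.Propositional using (_↭_)
open import Data.List.Relation.Unary.Linked using (Linked)
open import Data.Maybe using (Maybe; just; nothing; fromMaybe)
open import Data.Nat using (ℕ; suc; NonZero) renaming (_≥_ to _≥ᴺ_; _<_ to _<ᴺ_; _⊔_ to _⊔ᴺ_)
import Data.Nat as ℕ
import Data.Nat.Properties as ℕₚ
open import Data.Product using (∃-syntax; Σ-syntax; _×_; _,_)
open import Data.Rational using (ℚ; 0ℚ; ½)
import Data.Rational as ℚ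
import Data.Rational.Properties as ℚₚ
import Data.Rational.Unnormalised as ℚᵘ
import Data.Rational.Unnormalised.Properties as ℚᵘₚ
open import Data.Rational.Solver using (module +-*-Solver)
open import Data.Vec using (Vec; _[_]≔_; replicate; toList)
import Data.Vec as Vec
open import Data.Vec.Relation.Binary.Pointwise.Inductive using (Pointwise)
open import Relation.Binary.PropositionalEquality using (_≡_; refl; sym; cong; subst)
open import Relation.Nullary using (¬_)

IsCauchy : (ℕ → ℚ) → Set
IsCauchy a = ∀ ε → 0ℚ ℚ.< ε →
  ∃[ M ] (∀ p q → p ≥ᴺ M → q ≥ᴺ M → ℚ.∣ a p ℚ.- a q ∣ ℚ.≤ ε)

record ℝ : Set where
  constructor mkℝ
  field
    seq    : ℕ → ℚ
    cauchy : IsCauchy seq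

open ℝ public

infix 4 _≤_ _≥_ _<_ _≃_

data _≤_ (x y : ℝ) : Set where
  *≤* : (∀ ε → 0ℚ ℚ.< ε → ∃[ M ] (∀ n → n ≥ᴺ M → seq x n ℚ.≤ seq y n ℚ.+ ε)) → x ≤ y

_≥_ : ℝ → ℝ → Set
x ≥ y = y ≤ x

data _<_ (x y : ℝ) : Set where
  *<* : ∃[ ε ] (0ℚ ℚ.< ε × ∃[ M ] (∀ n → n ≥ᴺ M → seq x n ℚ.+ ε ℚ.≤ seq y n)) → x < y

-- Equality of reals; _≡_ on ℝ only compares representatives.
_≃_ : ℝ → ℝ → Set
x ≃ y = x ≤ y × y ≤ x

private
  abstract
    0<½ε : ∀ ε → 0ℚ ℚ.< ε → 0ℚ ℚ.< ½ ℚ.* ε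
    0<½ε ε 0<ε = subst (ℚ._< ½ ℚ.* ε) (ℚₚ.*-zeroʳ ½) (ℚₚ.*-monoʳ-<-pos ½ 0<ε)

    ½ε+½ε≡ε : ∀ ε → ½ ℚ.* ε ℚ.+ ½ ℚ.* ε ≡ ε
    ½ε+½ε≡ε = solve 1 (λ e → con ½ :* e :+ con ½ :* e := e) refl
      where open +-*-Solver

    +-cauchy : ∀ a b → IsCauchy a → IsCauchy b → IsCauchy (λ n → a n ℚ.+ b n)
    +-cauchy a b ca cb ε 0<ε with ca (½ ℚ.* ε) (0<½ε ε 0<ε) | cb (½ ℚ.* ε) (0<½ε ε 0<ε)
    ... | M , hM | L , hL = M ⊔ᴺ L , λ p q p≥ q≥ → begin
        ℚ.∣ (a p ℚ.+ b p) ℚ.- (a q ℚ.+ b q) ∣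
          ≡⟨ cong ℚ.∣_∣ (rearrange (a p) (b p) (a q) (b q)) ⟩
        ℚ.∣ (a p ℚ.- a q) ℚ.+ (b p ℚ.- b q) ∣
          ≤⟨ ℚₚ.∣p+q∣≤∣p∣+∣q∣ (a p ℚ.- a q) (b p ℚ.- b q) ⟩
        ℚ.∣ a p ℚ.- a q ∣ ℚ.+ ℚ.∣ b p ℚ.- b q ∣
          ≤⟨ ℚₚ.+-mono-≤
               (hM p q (ℕₚ.m⊔n≤o⇒m≤o M L p≥) (ℕₚ.m⊔n≤o⇒m≤o M L q≥))
               (hL p q (ℕₚ.m⊔n≤o⇒n≤o M L p≥) (ℕₚ.m⊔n≤o⇒n≤o M L q≥)) ⟩
        ½ ℚ.* ε ℚ.+ ½ ℚ.* ε
          ≡⟨ ½ε+½ε≡ε ε ⟩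
        ε ∎
      where
      open ℚₚ.≤-Reasoning
      rearrange : ∀ s t u v → (s ℚ.+ t) ℚ.- (u ℚ.+ v) ≡ (s ℚ.- u) ℚ.+ (t ℚ.- v)
      rearrange = solve 4 (λ s t u v → (s :+ t) :- (u :+ v) := (s :- u) :+ (t :- v)) refl
        where open +-*-Solver

    neg-cauchy : ∀ a → IsCauchy a → IsCauchy (λ n → ℚ.- a n)
    neg-cauchy a ca ε 0<ε with ca ε 0<ε
    ... | M , hM = M , λ p q p≥ q≥ → begin
        ℚ.∣ (ℚ.- a p) ℚ.- (ℚ.- a q) ∣  ≡⟨ cong ℚ.∣_∣ (sym (ℚₚ.neg-distrib-+ (a p) (ℚ.- a q))) ⟩
        ℚ.∣ ℚ.- (a p ℚ.- a q) ∣        ≡⟨ ℚₚ.∣-p∣≡∣p∣ (a p ℚ.- a q) ⟩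
        ℚ.∣ a p ℚ.- a q ∣              ≤⟨ hM p q p≥ q≥ ⟩
        ε                              ∎
      where open ℚₚ.≤-Reasoning

    1/d≤1 : ∀ d .{{_ : NonZero d}} → (+ 1 ℚ./ d) ℚ.≤ ℚ.1ℚ
    1/d≤1 (suc n) = ℚₚ.toℚᵘ-cancel-≤ (begin
        ℚ.toℚᵘ (+ 1 ℚ./ suc n)  ≃⟨ ℚₚ.toℚᵘ-fromℚᵘ (ℚᵘ.mkℚᵘ (+ 1) n) ⟩
        ℚᵘ.mkℚᵘ (+ 1) n         ≤⟨ ℚᵘ.*≤* (ℤ.+≤+ (ℕ.s≤s ℕ.z≤n)) ⟩
        ℚᵘ.1ℚᵘ                  ∎)
      where open ℚᵘₚ.≤-Reasoning

    0≤1/d : ∀ d .{{_ : NonZero d}} → ℚ.NonNegative (+ 1 ℚ./ d)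
    0≤1/d d = ℚₚ.normalize-nonNeg 1 d

    scale-cauchy : ∀ a r .{{_ : ℚ.NonNegative r}} → r ℚ.≤ ℚ.1ℚ → IsCauchy a → IsCauchy (λ n → a n ℚ.* r)
    scale-cauchy a r r≤1 ca ε 0<ε with ca ε 0<ε
    ... | M , hM = M , λ p q p≥ q≥ → begin
        ℚ.∣ a p ℚ.* r ℚ.- a q ℚ.* r ∣  ≡⟨ cong ℚ.∣_∣ (factor (a p) (a q) r) ⟩
        ℚ.∣ (a p ℚ.- a q) ℚ.* r ∣      ≡⟨ ℚₚ.∣p*q∣≡∣p∣*∣q∣ (a p ℚ.- a q) r ⟩
        ℚ.∣ a p ℚ.- a q ∣ ℚ.* ℚ.∣ r ∣  ≡⟨ cong (ℚ.∣ a p ℚ.- a q ∣ ℚ.*_) (ℚₚ.0≤p⇒∣p∣≡p (ℚₚ.nonNegative⁻¹ r)) ⟩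
        ℚ.∣ a p ℚ.- a q ∣ ℚ.* r        ≤⟨ ℚₚ.*-monoʳ-≤-nonNeg r (hM p q p≥ q≥) ⟩
        ε ℚ.* r                        ≤⟨ ℚₚ.*-monoˡ-≤-nonNeg ε r≤1 ⟩
        ε ℚ.* ℚ.1ℚ                     ≡⟨ ℚₚ.*-identityʳ ε ⟩
        ε                              ∎
      where
      open ℚₚ.≤-Reasoning
      instance
        ε≥0 : ℚ.NonNegative ε
        ε≥0 = ℚ.nonNegative (ℚₚ.<⇒≤ 0<ε)
      factor : ∀ s t u → s ℚ.* u ℚ.- t ℚ.* u ≡ (s ℚ.- t) ℚ.* u
      factor = solve 3 (λ s t u → s :* u :- t :* u := (s :- t) :* u) refl
        where open +-*-Solver

    /-cauchy : ∀ a d .{{_ : NonZero d}} → IsCauchy a → IsCauchy (λ n → a n ℚ.* (+ 1 ℚ./ d))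
    /-cauchy a d = scale-cauchy a (+ 1 ℚ./ d) {{0≤1/d d}} (1/d≤1 d)

infixl 6 _+_ _-_
infixl 7 _/_

0ℝ : ℝ
0ℝ = mkℝ (λ _ → 0ℚ) (λ ε 0<ε → 0 , λ _ _ _ _ → ℚₚ.<⇒≤ 0<ε)

_+_ : ℝ → ℝ → ℝ
x + y = mkℝ (λ n → seq x n ℚ.+ seq y n) (+-cauchy (seq x) (seq y) (cauchy x) (cauchy y))

-_ : ℝ → ℝ
- x = mkℝ (λ n → ℚ.- seq x n) (neg-cauchy (seq x) (cauchy x))

_-_ : ℝ → ℝ → ℝ
x - y = x + (- y)

_/_ : ℝ → (d : ℕ) .{{_ : NonZero d}} → ℝ
x / d = mkℝ (λ n → seq x n ℚ.* (+ 1 ℚ./ d)) (/-cauchy (seq x) d (cauchy x))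

sum : List ℝ → ℝ
sum = foldr _+_ 0ℝ

-- Rankings, and below the steps of Reduce-By-Median-Counter, are relations rather than
-- functions because the order of ℝ is not decidable constructively.

-- ys lists xs from largest to smallest, ties in any order.
_RanksAs_ : List ℝ → List ℝ → Set
xs RanksAs ys = ys ↭ xs × Linked _≥_ ys

-- Multiplicities count, and r is 1-based.
IsLargest : ℕ → List ℝ → ℝ → Set
IsLargest r xs c =
  ∃[ ys ] (xs RanksAs ys × Σ[ p ∈ Fin (length ys) ] (suc (toℕ p) ≡ r × c ≃ lookup ys p))

-- The universe [m] is Fin m.
record WeightedItem (m : ℕ) : Set where
  constructor mkWeightedItem
  field
    item     : Fin m
    weight   : ℝ
    positive : 0ℝ < weight

open WeightedItem public

Stream : ℕ → Set
Stream m = List (WeightedItem m)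

frequency : ∀ {m} → Stream m → Fin m → ℝ
frequency σ i = sum (map weight (filter (λ u → item u ≟ᶠ i) σ))

frequencies : ∀ {m} → Stream m → List ℝ
frequencies σ = toList (Vec.tabulate (frequency σ))

-- R is N^res(j); for j ≥ m no item is left, and R is 0.
IsResidual : ∀ {m} → Stream m → ℕ → ℝ → Set
IsResidual σ j R = ∃[ fs ] (frequencies σ RanksAs fs × R ≃ sum (drop j fs))

-- Entry i is just c(i) if i ∈ T, and nothing if i ∉ T.
State : ℕ → Set
State m = Vec (Maybe ℝ) m

initial : ∀ {m} → State m
initial = replicate _ nothing

counters : ∀ {m} → State m → List ℝ
counters s = catMaybes (toList s)

∣_∣ : ∀ {m} → State m → ℕ
∣ s ∣ = length (counters s)

estimate : ∀ {m} → State m → Fin m → ℝ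
estimate s i = fromMaybe 0ℝ (Vec.lookup s i)

data DecrementCounter (c : ℝ) : Maybe ℝ → Maybe ℝ → Set where
  absent : DecrementCounter c nothing nothing
  remove : ∀ {x} → x - c ≤ 0ℝ → DecrementCounter c (just x) nothing
  keep   : ∀ {x} → ¬ (x - c ≤ 0ℝ) → DecrementCounter c (just x) (just (x - c))

-- c is the value c_{k*} computed by the call.
DecrementCounters : ∀ {m} (k* : ℕ) → State m → (c : ℝ) → State m → Set
DecrementCounters k* s c s′ =
  IsLargest k* (counters s) c × Pointwise (DecrementCounter c) s s′

data Update {m : ℕ} (k k* : ℕ) (s : State m) (u : WeightedItem m) : State m → Set where
  increment : ∀ {x} →
    Vec.lookup s (item u) ≡ just x →
    Update k k* s u (s [ item u ]≔ just (x + weight u))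
  insert :
    Vec.lookup s (item u) ≡ nothing →
    ∣ s ∣ <ᴺ k →
    Update k k* s u (s [ item u ]≔ just (weight u))
  decrement-insert : ∀ {c s′} →
    Vec.lookup s (item u) ≡ nothing →
    ¬ (∣ s ∣ <ᴺ k) →
    DecrementCounters k* s c s′ →
    weight u ≥ c →
    Update k k* s u (s′ [ item u ]≔ just (weight u - c))
  decrement-discard : ∀ {c s′} →
    Vec.lookup s (item u) ≡ nothing →
    ¬ (∣ s ∣ <ᴺ k) →
    DecrementCounters k* s c s′ →
    ¬ (weight u ≥ c) →
    Update k k* s u s′

data Run {m : ℕ} (k k* : ℕ) : State m → Stream m → State m → Set where
  []  : ∀ {s} → Run k k* s [] s
  _∷_ : ∀ {s s′ s″ u σ} → Update k k* s u s′ → Run k k* s′ σ s″ → Run k k* s (u ∷ σ) s″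

{-# OPTIONS --safe #-}
module Submission where

-- Let E be the sum of the values c_{k*} subtracted over all calls of DecrementCounters.
-- A call increases the error f_i − est_i of every item by at most c_{k*}, and the errors of
-- the k* largest counters by exactly c_{k*}, so every error is at most E while k* E ≤ Σ errors.
-- The j most frequent items contribute at most j E to that sum, and every other item at most
-- its frequency, so (k* − j) E ≤ N^res(j).

open import Defs
open import Data.Nat using (ℕ; zero; suc; _∸_; >-nonZero; NonZero) renaming (_≤_ to _≤ᴺ_; _<_ to _<ᴺ_)
import Data.Nat as ℕ
import Data.Nat.Properties as ℕₚ
open import Data.Nat.Properties using (m<n⇒0<n∸m)
open import Data.Fin using (Fin; zero; suc; toℕ)
open import Data.Fin.Properties using () renaming (_≟_ to _≟ᶠ_)
open import Data.Integer using (+_)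
import Data.Integer as ℤ
import Data.Integer.Properties as ℤₚ
open import Data.List using ([]; _∷_; map; drop; lookup; length)
open import Data.List.Properties using (filter-accept; filter-reject)
open import Data.List.Relation.Binary.Permutation.Propositional using (_↭_; refl; prep; swap; trans; ↭-sym)
open import Data.List.Relation.Binary.Permutation.Propositional.Properties using (All-resp-↭)
import Data.List.Relation.Binary.Pointwise as List
open import Data.List.Relation.Binary.Pointwise using ([]; _∷_)
open import Data.List.Relation.Unary.All as All using (All; []; _∷_)
open import Data.List.Relation.Unary.AllPairs using (AllPairs; []; _∷_)
open import Data.List.Relation.Unary.Linked using (Linked)
open import Data.List.Relation.Unary.Linked.Properties using (Linked⇒AllPairs)
open import Data.List.Membership.Propositional.Properties using (∈-lookup)
open import Data.Maybe using (Maybe; just; nothing; fromMaybe)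
open import Data.Product using (_×_; _,_; proj₁; proj₂; ∃-syntax)
open import Data.Rational using (0ℚ; 1ℚ; ½)
import Data.Rational as ℚ
import Data.Rational.Properties as ℚₚ
open import Data.Rational.Solver using (module +-*-Solver)
open import Data.Rational.Unnormalised using (mkℚᵘ; *≡*)
import Data.Rational.Unnormalised as ℚᵘ
import Data.Rational.Unnormalised.Properties as ℚᵘₚ
open import Data.Sum using (inj₁; inj₂)
open import Data.Vec using ([]; _∷_; _[_]≔_; tabulate; toList)
import Data.Vec as Vec
open import Data.Vec.Properties using (lookup∘update; lookup∘update′; lookup-replicate)
import Data.Vec.Relation.Binary.Pointwise.Inductive as Vecᴾ
open import Data.Vec.Relation.Binary.Pointwise.Inductive using ([]; _∷_)
open import Function using (_∘_)
open import Relation.Binary.PropositionalEquality using (_≡_; _≢_; refl; sym; cong; subst; module ≡-Reasoning) renaming (trans to ≡-trans)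
open import Relation.Nullary using (¬_; yes; no; contradiction)
open +-*-Solver using (solve; con; _:=_; _:+_; _:*_; _:-_; :-_)

-- Order and addition on ℝ

half-pos : ∀ {ε} → 0ℚ ℚ.< ε → 0ℚ ℚ.< ½ ℚ.* ε
half-pos {ε} 0<ε = subst (ℚ._< ½ ℚ.* ε) (ℚₚ.*-zeroʳ ½) (ℚₚ.*-monoʳ-<-pos ½ 0<ε)

-- Carries algebraic identities into chains of inequalities: an identity between reals is proved
-- index by index, mostly by the rational ring solver, and enters through here.
≗⇒≤ : ∀ {x y} → (∀ n → seq x n ≡ seq y n) → x ≤ y
≗⇒≤ {x} {y} eq = *≤* λ ε 0<ε → 0 , λ n _ → begin
    seq x n           ≡⟨ eq n ⟩
    seq y n           ≡⟨ ℚₚ.+-identityʳ (seq y n) ⟨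
    seq y n ℚ.+ 0ℚ    ≤⟨ ℚₚ.+-monoʳ-≤ (seq y n) (ℚₚ.<⇒≤ 0<ε) ⟩
    seq y n ℚ.+ ε     ∎
  where open ℚₚ.≤-Reasoning

≤-refl : ∀ {x} → x ≤ x
≤-refl = ≗⇒≤ λ _ → refl

≤-trans : ∀ {x y z} → x ≤ y → y ≤ z → x ≤ z
≤-trans {x} {y} {z} (*≤* x≤y) (*≤* y≤z) = *≤* λ ε 0<ε →
  let M , p = x≤y (½ ℚ.* ε) (half-pos 0<ε)
      L , q = y≤z (½ ℚ.* ε) (half-pos 0<ε)
  in M ℕ.⊔ L , λ n n≥ → begin
    seq x n                              ≤⟨ p n (ℕₚ.m⊔n≤o⇒m≤o M L n≥) ⟩
    seq y n ℚ.+ ½ ℚ.* ε                  ≤⟨ ℚₚ.+-monoˡ-≤ (½ ℚ.* ε) (q n (ℕₚ.m⊔n≤o⇒n≤o M L n≥)) ⟩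
    seq z n ℚ.+ ½ ℚ.* ε ℚ.+ ½ ℚ.* ε      ≡⟨ solve 2 (λ a e → a :+ con ½ :* e :+ con ½ :* e := a :+ e) refl (seq z n) ε ⟩
    seq z n ℚ.+ ε                        ∎
  where open ℚₚ.≤-Reasoning

+-mono-≤ : ∀ {x y u v} → x ≤ y → u ≤ v → x + u ≤ y + v
+-mono-≤ {x} {y} {u} {v} (*≤* x≤y) (*≤* u≤v) = *≤* λ ε 0<ε →
  let M , p = x≤y (½ ℚ.* ε) (half-pos 0<ε)
      L , q = u≤v (½ ℚ.* ε) (half-pos 0<ε)
  in M ℕ.⊔ L , λ n n≥ → begin
    seq x n ℚ.+ seq u n
      ≤⟨ ℚₚ.+-mono-≤ (p n (ℕₚ.m⊔n≤o⇒m≤o M L n≥)) (q n (ℕₚ.m⊔n≤o⇒n≤o M L n≥)) ⟩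
    (seq y n ℚ.+ ½ ℚ.* ε) ℚ.+ (seq v n ℚ.+ ½ ℚ.* ε)
      ≡⟨ solve 3 (λ a b e → (a :+ con ½ :* e) :+ (b :+ con ½ :* e) := a :+ b :+ e) refl (seq y n) (seq v n) ε ⟩
    seq y n ℚ.+ seq v n ℚ.+ ε ∎
  where open ℚₚ.≤-Reasoning

<⇒≤ : ∀ {x y} → x < y → x ≤ y
<⇒≤ {x} {y} (*<* (δ , 0<δ , M , p)) = *≤* λ ε 0<ε → M , λ n n≥ → begin
    seq x n           ≡⟨ ℚₚ.+-identityʳ (seq x n) ⟨
    seq x n ℚ.+ 0ℚ    ≤⟨ ℚₚ.+-monoʳ-≤ (seq x n) (ℚₚ.<⇒≤ 0<δ) ⟩
    seq x n ℚ.+ δ     ≤⟨ p n n≥ ⟩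
    seq y n           ≡⟨ ℚₚ.+-identityʳ (seq y n) ⟨
    seq y n ℚ.+ 0ℚ    ≤⟨ ℚₚ.+-monoʳ-≤ (seq y n) (ℚₚ.<⇒≤ 0<ε) ⟩
    seq y n ℚ.+ ε     ∎
  where open ℚₚ.≤-Reasoning

∣p-q∣≤ε⇒p≤q+ε : ∀ p q {ε} → ℚ.∣ p ℚ.- q ∣ ℚ.≤ ε → p ℚ.≤ q ℚ.+ ε
∣p-q∣≤ε⇒p≤q+ε p q {ε} h = begin
    p                      ≡⟨ solve 2 (λ a b → a := b :+ (a :- b)) refl p q ⟩
    q ℚ.+ (p ℚ.- q)        ≤⟨ ℚₚ.+-monoʳ-≤ q (ℚₚ.≤-trans (p≤∣p∣ (p ℚ.- q)) h) ⟩
    q ℚ.+ ε                ∎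
  where
  open ℚₚ.≤-Reasoning
  p≤∣p∣ : ∀ r → r ℚ.≤ ℚ.∣ r ∣
  p≤∣p∣ r with ℚₚ.≤-total 0ℚ r
  ... | inj₁ 0≤r = ℚₚ.≤-reflexive (sym (ℚₚ.0≤p⇒∣p∣≡p 0≤r))
  ... | inj₂ r≤0 = ℚₚ.≤-trans r≤0 (ℚₚ.0≤∣p∣ r)

-- Whether 0 ≤ x + ε is decided on one rational approximation of x.
≰0⇒≥0 : ∀ {x} → ¬ (x ≤ 0ℝ) → 0ℝ ≤ x
≰0⇒≥0 {x} x≰0 = *≤* λ ε 0<ε → approx ε 0<ε (cauchy x (½ ℚ.* ε) (half-pos 0<ε))
  where
  open ℚₚ.≤-Reasoning
  approx : ∀ ε → 0ℚ ℚ.< ε →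
    ∃[ M ] (∀ p q → p ℕ.≥ M → q ℕ.≥ M → ℚ.∣ seq x p ℚ.- seq x q ∣ ℚ.≤ ½ ℚ.* ε) →
    ∃[ M ] (∀ n → n ℕ.≥ M → 0ℚ ℚ.≤ seq x n ℚ.+ ε)
  approx ε 0<ε (M , close) with 0ℚ ℚ.≤? seq x M ℚ.+ ½ ℚ.* ε
  ... | yes 0≤ = M , λ n n≥ → begin
    0ℚ                                 ≤⟨ 0≤ ⟩
    seq x M ℚ.+ ½ ℚ.* ε                ≤⟨ ℚₚ.+-monoˡ-≤ (½ ℚ.* ε) (∣p-q∣≤ε⇒p≤q+ε (seq x M) (seq x n) (close M n ℕₚ.≤-refl n≥)) ⟩
    seq x n ℚ.+ ½ ℚ.* ε ℚ.+ ½ ℚ.* ε    ≡⟨ solve 2 (λ a e → a :+ con ½ :* e :+ con ½ :* e := a :+ e) refl (seq x n) ε ⟩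
    seq x n ℚ.+ ε                      ∎
  ... | no 0≰ = contradiction x≤0 x≰0
    where
    x≤0 : x ≤ 0ℝ
    x≤0 = *≤* λ η 0<η → M , λ n n≥ → begin
      seq x n                  ≤⟨ ∣p-q∣≤ε⇒p≤q+ε (seq x n) (seq x M) (close n M n≥ ℕₚ.≤-refl) ⟩
      seq x M ℚ.+ ½ ℚ.* ε      ≤⟨ ℚₚ.<⇒≤ (ℚₚ.≰⇒> 0≰) ⟩
      0ℚ                       ≤⟨ ℚₚ.<⇒≤ 0<η ⟩
      η                        ≡⟨ ℚₚ.+-identityˡ η ⟨
      0ℚ ℚ.+ η                 ∎

x-y≤0⇒x≤y : ∀ {x y} → x - y ≤ 0ℝ → x ≤ y
x-y≤0⇒x≤y {x} {y} h =
  ≤-trans (≗⇒≤ λ n → solve 2 (λ a b → a := (a :- b) :+ b) refl (seq x n) (seq y n))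
    (≤-trans (+-mono-≤ h (≤-refl {y})) (≗⇒≤ λ n → ℚₚ.+-identityˡ (seq y n)))

x≤y⇒0≤y-x : ∀ {x y} → x ≤ y → 0ℝ ≤ y - x
x≤y⇒0≤y-x {x} x≤y =
  ≤-trans (≗⇒≤ λ n → sym (ℚₚ.+-inverseʳ (seq x n))) (+-mono-≤ x≤y ≤-refl)

0≤x-y⇒y≤x : ∀ {x y} → 0ℝ ≤ x - y → y ≤ x
0≤x-y⇒y≤x {x} {y} h =
  ≤-trans (≗⇒≤ λ n → sym (ℚₚ.+-identityˡ (seq y n)))
    (≤-trans (+-mono-≤ h (≤-refl {y})) (≗⇒≤ λ n → solve 2 (λ a b → (a :- b) :+ b := a) refl (seq x n) (seq y n)))

-- Serves the case `decrement-discard`, whose premise on the weight is only a negated inequality.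
≰⇒≥ : ∀ {x y} → ¬ (x ≤ y) → y ≤ x
≰⇒≥ x≰y = 0≤x-y⇒y≤x (≰0⇒≥0 (x≰y ∘ x-y≤0⇒x≤y))

+-nonNeg : ∀ {x y} → 0ℝ ≤ x → 0ℝ ≤ y → 0ℝ ≤ x + y
+-nonNeg 0≤x 0≤y = ≤-trans (≗⇒≤ λ _ → refl) (+-mono-≤ 0≤x 0≤y)

+-cancelˡ-≤ : ∀ x {y z} → x + y ≤ x + z → y ≤ z
+-cancelˡ-≤ x {y} {z} h =
  ≤-trans (≗⇒≤ λ n → solve 2 (λ a b → b := :- a :+ (a :+ b)) refl (seq x n) (seq y n))
    (≤-trans (+-mono-≤ (≤-refl { - x}) h)
      (≗⇒≤ λ n → solve 2 (λ a b → :- a :+ (a :+ b) := b) refl (seq x n) (seq z n)))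

-- Multiples and division

infixr 7 _·_

-- Repeated addition suits inductions along ranked lists; `·≡*` links it to the rational product
-- that underlies `_/_`.
_·_ : ℕ → ℝ → ℝ
zero  · x = 0ℝ
suc n · x = x + n · x

·-zeroʳ : ∀ k n → seq (k · 0ℝ) n ≡ 0ℚ
·-zeroʳ zero    n = refl
·-zeroʳ (suc k) n = cong (0ℚ ℚ.+_) (·-zeroʳ k n)

·-distribˡ-+ : ∀ k x y n → seq (k · (x + y)) n ≡ seq (k · x + k · y) n
·-distribˡ-+ zero    x y n = refl
·-distribˡ-+ (suc k) x y n = ≡-trans (cong ((seq x n ℚ.+ seq y n) ℚ.+_) (·-distribˡ-+ k x y n))
  (solve 4 (λ a b c d → (a :+ b) :+ (c :+ d) := (a :+ c) :+ (b :+ d)) refl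
    (seq x n) (seq y n) (seq (k · x) n) (seq (k · y) n))

-- Induction on `j ≤ᴺ k` cancels one copy of `x` from both sides at each step.
·-cancel-≤ : ∀ {j k} → j ≤ᴺ k → ∀ {x y} → k · x ≤ j · x + y → (k ∸ j) · x ≤ y
·-cancel-≤ ℕ.z≤n {y = y} h = ≤-trans h (≗⇒≤ λ n → ℚₚ.+-identityˡ (seq y n))
·-cancel-≤ {suc j} (ℕ.s≤s j≤k) {x} {y} h = ·-cancel-≤ j≤k (+-cancelˡ-≤ x (≤-trans h
  (≗⇒≤ λ n → ℚₚ.+-assoc (seq x n) (seq (j · x) n) (seq y n))))

-- The operation `ℚ./` normalises by a gcd that does not compute for a variable `n`, so the equation
-- is checked on unnormalised fractions.
suc/1 : ∀ n → + suc n ℚ./ 1 ≡ 1ℚ ℚ.+ + n ℚ./ 1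
suc/1 n = ℚₚ.toℚᵘ-injective (begin
    ℚ.toℚᵘ (+ suc n ℚ./ 1)                 ≈⟨ ℚₚ.toℚᵘ-fromℚᵘ (mkℚᵘ (+ suc n) 0) ⟩
    mkℚᵘ (+ suc n) 0                       ≈⟨ *≡* (cong (λ z → (+ 1 ℤ.+ z) ℤ.* + 1) (sym (ℤₚ.*-identityʳ (+ n)))) ⟩
    ℚᵘ.1ℚᵘ ℚᵘ.+ mkℚᵘ (+ n) 0               ≈⟨ ℚᵘₚ.+-congʳ ℚᵘ.1ℚᵘ (ℚᵘₚ.≃-sym (ℚₚ.toℚᵘ-fromℚᵘ (mkℚᵘ (+ n) 0))) ⟩
    ℚᵘ.1ℚᵘ ℚᵘ.+ ℚ.toℚᵘ (+ n ℚ./ 1)         ≈⟨ ℚᵘₚ.≃-sym (ℚₚ.toℚᵘ-homo-+ 1ℚ (+ n ℚ./ 1)) ⟩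
    ℚ.toℚᵘ (1ℚ ℚ.+ + n ℚ./ 1)              ∎)
  where open import Relation.Binary.Reasoning.Setoid ℚᵘₚ.≃-setoid

d/1*1/d≡1 : ∀ d .{{_ : NonZero d}} → (+ d ℚ./ 1) ℚ.* (+ 1 ℚ./ d) ≡ 1ℚ
d/1*1/d≡1 d@(suc e) = ℚₚ.toℚᵘ-injective (begin
    ℚ.toℚᵘ ((+ d ℚ./ 1) ℚ.* (+ 1 ℚ./ d))           ≈⟨ ℚₚ.toℚᵘ-homo-* (+ d ℚ./ 1) (+ 1 ℚ./ d) ⟩
    ℚ.toℚᵘ (+ d ℚ./ 1) ℚᵘ.* ℚ.toℚᵘ (+ 1 ℚ./ d)     ≈⟨ ℚᵘₚ.*-cong (ℚₚ.toℚᵘ-fromℚᵘ (mkℚᵘ (+ d) 0)) (ℚₚ.toℚᵘ-fromℚᵘ (mkℚᵘ (+ 1) e)) ⟩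
    mkℚᵘ (+ d) 0 ℚᵘ.* mkℚᵘ (+ 1) e                 ≈⟨ *≡* (≡-trans (ℤₚ.*-identityʳ _) (≡-trans (ℤₚ.*-comm (+ d) (+ 1)) (cong (λ z → + 1 ℤ.* + z) (sym (ℕₚ.*-identityˡ d))))) ⟩
    ℚᵘ.1ℚᵘ                                         ∎)
  where open import Relation.Binary.Reasoning.Setoid ℚᵘₚ.≃-setoid

·≡* : ∀ k x n → seq (k · x) n ≡ (+ k ℚ./ 1) ℚ.* seq x n
·≡* zero    x n = sym (ℚₚ.*-zeroˡ (seq x n))
·≡* (suc k) x n = begin
    seq x n ℚ.+ seq (k · x) n                  ≡⟨ cong (seq x n ℚ.+_) (·≡* k x n) ⟩
    seq x n ℚ.+ (+ k ℚ./ 1) ℚ.* seq x n        ≡⟨ solve 2 (λ a c → a :+ c :* a := (con 1ℚ :+ c) :* a) refl (seq x n) (+ k ℚ./ 1) ⟩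
    (1ℚ ℚ.+ + k ℚ./ 1) ℚ.* seq x n             ≡⟨ cong (ℚ._* seq x n) (suc/1 k) ⟨
    (+ suc k ℚ./ 1) ℚ.* seq x n                ∎
  where open ≡-Reasoning

·-/-inverse : ∀ d .{{_ : NonZero d}} x n → seq ((d · x) / d) n ≡ seq x n
·-/-inverse d x n = begin
    seq (d · x) n ℚ.* (+ 1 ℚ./ d)                      ≡⟨ cong (ℚ._* (+ 1 ℚ./ d)) (·≡* d x n) ⟩
    (+ d ℚ./ 1) ℚ.* seq x n ℚ.* (+ 1 ℚ./ d)            ≡⟨ solve 3 (λ a b c → a :* b :* c := (a :* c) :* b) refl (+ d ℚ./ 1) (seq x n) (+ 1 ℚ./ d) ⟩
    (+ d ℚ./ 1) ℚ.* (+ 1 ℚ./ d) ℚ.* seq x n            ≡⟨ cong (ℚ._* seq x n) (d/1*1/d≡1 d) ⟩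
    1ℚ ℚ.* seq x n                                     ≡⟨ ℚₚ.*-identityˡ (seq x n) ⟩
    seq x n                                            ∎
  where open ≡-Reasoning

/-mono-≤ : ∀ d .{{_ : NonZero d}} {x y} → x ≤ y → x / d ≤ y / d
/-mono-≤ d {x} {y} (*≤* x≤y) = *≤* λ ε 0<ε →
  -- Division by `d` shrinks a tolerance `d ε` to `ε`.
  let δ = (+ d ℚ./ 1) ℚ.* ε
      0<δ = subst (ℚ._< δ) (ℚₚ.*-zeroʳ (+ d ℚ./ 1)) (ℚₚ.*-monoʳ-<-pos (+ d ℚ./ 1) {{ℚₚ.normalize-pos d 1}} 0<ε)
      M , p = x≤y δ 0<δ
  in M , λ n n≥ → begin
    seq x n ℚ.* r                                  ≤⟨ ℚₚ.*-monoʳ-≤-nonNeg r {{ℚₚ.normalize-nonNeg 1 d}} (p n n≥) ⟩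
    (seq y n ℚ.+ δ) ℚ.* r                          ≡⟨ solve 4 (λ a b c e → (a :+ b :* e) :* c := a :* c :+ (b :* c) :* e) refl (seq y n) (+ d ℚ./ 1) r ε ⟩
    seq y n ℚ.* r ℚ.+ (+ d ℚ./ 1) ℚ.* r ℚ.* ε      ≡⟨ cong (λ z → seq y n ℚ.* r ℚ.+ z ℚ.* ε) (d/1*1/d≡1 d) ⟩
    seq y n ℚ.* r ℚ.+ 1ℚ ℚ.* ε                     ≡⟨ cong (seq y n ℚ.* r ℚ.+_) (ℚₚ.*-identityˡ ε) ⟩
    seq y n ℚ.* r ℚ.+ ε                            ∎
  where
  open ℚₚ.≤-Reasoning
  r = + 1 ℚ./ d

·-≤⇒≤-/ : ∀ d .{{_ : NonZero d}} {x y} → d · x ≤ y → x ≤ y / d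
·-≤⇒≤-/ d {x} h = ≤-trans (≗⇒≤ λ n → sym (·-/-inverse d x n)) (/-mono-≤ d h)

-- Sums

sum-nonNeg : ∀ {xs} → All (0ℝ ≤_) xs → 0ℝ ≤ sum xs
sum-nonNeg []         = ≤-refl
sum-nonNeg (0≤x ∷ ps) = +-nonNeg 0≤x (sum-nonNeg ps)

sum-↭ : ∀ {xs ys} → xs ↭ ys → sum xs ≤ sum ys
sum-↭ refl         = ≤-refl
sum-↭ (prep x p)   = +-mono-≤ ≤-refl (sum-↭ p)
sum-↭ {ys = _ ∷ _ ∷ ys} (swap x y p) =
  ≤-trans (+-mono-≤ (≤-refl {x}) (+-mono-≤ (≤-refl {y}) (sum-↭ p)))
    (≗⇒≤ λ n → solve 3 (λ a b c → a :+ (b :+ c) := b :+ (a :+ c)) refl (seq x n) (seq y n) (seq (sum ys) n))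
sum-↭ (trans p q)  = ≤-trans (sum-↭ p) (sum-↭ q)

-- A ranking permutes only the list being ranked. Moving the partner list in parallel keeps each
-- counter next to its drop, and each frequency next to its loss.
pointwise-↭ : ∀ {P : ℝ → ℝ → Set} {xs ys ls} → xs ↭ ys → List.Pointwise P xs ls →
  ∃[ ms ] (List.Pointwise P ys ms × ms ↭ ls)
pointwise-↭ refl ps = _ , ps , refl
pointwise-↭ (prep x p) (q ∷ ps) =
  let _ , rs , r = pointwise-↭ p ps in _ , q ∷ rs , prep _ r
pointwise-↭ (swap x y p) (q₁ ∷ q₂ ∷ ps) =
  let _ , rs , r = pointwise-↭ p ps in _ , q₂ ∷ q₁ ∷ rs , swap _ _ r
pointwise-↭ (trans p₁ p₂) ps =
  let _ , qs , q = pointwise-↭ p₁ ps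
      _ , rs , r = pointwise-↭ p₂ qs
  in _ , rs , trans r q

-- Sums over the universe

Σ : ∀ {m} → (Fin m → ℝ) → ℝ
Σ f = sum (toList (tabulate f))

Σ-mono-≤ : ∀ {m} {f g : Fin m → ℝ} → (∀ i → f i ≤ g i) → Σ f ≤ Σ g
Σ-mono-≤ {zero}  f≤g = ≤-refl
Σ-mono-≤ {suc m} f≤g = +-mono-≤ (f≤g zero) (Σ-mono-≤ (f≤g ∘ suc))

Σ-+ : ∀ {m} (f g : Fin m → ℝ) n → seq (Σ f + Σ g) n ≡ seq (Σ (λ i → f i + g i)) n
Σ-+ {zero}  f g n = refl
Σ-+ {suc m} f g n = ≡-trans
  (solve 4 (λ a b c d → (a :+ b) :+ (c :+ d) := (a :+ c) :+ (b :+ d)) refl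
    (seq (f zero) n) (seq (Σ (f ∘ suc)) n) (seq (g zero) n) (seq (Σ (g ∘ suc)) n))
  (cong ((seq (f zero) n ℚ.+ seq (g zero) n) ℚ.+_) (Σ-+ (f ∘ suc) (g ∘ suc) n))

Σ-nonNeg : ∀ {m} {f : Fin m → ℝ} → (∀ i → 0ℝ ≤ f i) → 0ℝ ≤ Σ f
Σ-nonNeg {zero}  0≤f = ≤-refl
Σ-nonNeg {suc m} 0≤f = +-nonNeg (0≤f zero) (Σ-nonNeg (0≤f ∘ suc))

pointwise-tabulate : ∀ {P : ℝ → ℝ → Set} {m} {f g : Fin m → ℝ} → (∀ i → P (f i) (g i)) →
  List.Pointwise P (toList (tabulate f)) (toList (tabulate g))
pointwise-tabulate {m = zero}  p = []
pointwise-tabulate {m = suc m} p = p zero ∷ pointwise-tabulate (p ∘ suc)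

-- Every entry of `ys` up to position `p` is at least `lookup ys p`, hence at least `c`, so its
-- partner in `ls` contributes at least `c`. The partners after position `p` are nonnegative.
multiple-of-rank≤sum : ∀ {c ys ls} → Linked _≥_ ys → (p : Fin (length ys)) → c ≤ lookup ys p →
  List.Pointwise (λ y l → 0ℝ ≤ l × (c ≤ y → c ≤ l)) ys ls → suc (toℕ p) · c ≤ sum ls
multiple-of-rank≤sum sorted = go (Linked⇒AllPairs (λ y≤x z≤y → ≤-trans z≤y y≤x) sorted)
  where
  nonNeg : ∀ {c ys ls} → List.Pointwise (λ y l → 0ℝ ≤ l × (c ≤ y → c ≤ l)) ys ls → All (0ℝ ≤_) ls
  nonNeg []             = []
  nonNeg ((0≤l , _) ∷ ps) = 0≤l ∷ nonNeg ps
  go : ∀ {c ys ls} → AllPairs _≥_ ys → (p : Fin (length ys)) → c ≤ lookup ys p →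
    List.Pointwise (λ y l → 0ℝ ≤ l × (c ≤ y → c ≤ l)) ys ls → suc (toℕ p) · c ≤ sum ls
  go _            zero    c≤y ((_ , c≤l) ∷ ps) = +-mono-≤ (c≤l c≤y) (sum-nonNeg (nonNeg ps))
  go (y≥ ∷ pairs) (suc p) c≤y ((_ , c≤l) ∷ ps) =
    +-mono-≤ (c≤l (≤-trans c≤y (All.lookup y≥ (∈-lookup p)))) (go pairs p c≤y ps)

-- The first `j` entries of `es` are charged `E` each, and every later one is charged its partner in
-- `fs`.
sum≤multiple+sum-drop : ∀ {E fs es} → 0ℝ ≤ E → ∀ j →
  List.Pointwise (λ f e → e ≤ f × e ≤ E) fs es → sum es ≤ j · E + sum (drop j fs)
sum≤multiple+sum-drop 0≤E zero [] = +-nonNeg ≤-refl ≤-refl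
sum≤multiple+sum-drop {fs = f ∷ fs} 0≤E zero ((e≤f , _) ∷ ps) =
  ≤-trans (+-mono-≤ {y = f} {v = sum fs} e≤f (≤-trans (sum≤multiple+sum-drop 0≤E zero ps) (≗⇒≤ λ n → ℚₚ.+-identityˡ _)))
    (≗⇒≤ λ n → sym (ℚₚ.+-identityˡ _))
-- With fewer than `j` entries in all, the copies of `E` left over are nonnegative.
sum≤multiple+sum-drop 0≤E (suc j) [] = +-nonNeg (+-nonNeg 0≤E (·-nonNeg j)) ≤-refl
  where
  ·-nonNeg : ∀ j → 0ℝ ≤ j · _
  ·-nonNeg zero    = ≤-refl
  ·-nonNeg (suc j) = +-nonNeg 0≤E (·-nonNeg j)
sum≤multiple+sum-drop {E} {f ∷ fs} 0≤E (suc j) ((_ , e≤E) ∷ ps) =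
  ≤-trans (+-mono-≤ e≤E (sum≤multiple+sum-drop 0≤E j ps))
    (≗⇒≤ λ n → sym (ℚₚ.+-assoc (seq E n) (seq (j · E) n) (seq (sum (drop j fs)) n)))

-- The algorithm

NonNeg : ∀ {m} → State m → Set
NonNeg s = ∀ i → 0ℝ ≤ estimate s i

-- The error accumulated between two states. Counting the estimate in the first state as correct
-- makes losses additive along a run, and from `initial` the loss is the error of the final
-- estimate.
loss : ∀ {m} → State m → Stream m → State m → Fin m → ℝ
loss s σ s′ i = (estimate s i + frequency σ i) - estimate s′ i

-- The invariant of a run, where `E` is the total subtracted by the calls of `DecrementCounters`.
-- All its bounds are additive, so it can be established one update at a time.
Spread : ∀ {m} → ℕ → (Fin m → ℝ) → ℝ → Set
Spread k* l E = (∀ i → 0ℝ ≤ l i × l i ≤ E) × k* · E ≤ Σ l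

spread-zero : ∀ {m k*} {l : Fin m → ℝ} → (∀ i n → seq (l i) n ≡ 0ℚ) → Spread k* l 0ℝ
spread-zero {k* = k*} l≡0 = (λ i → 0≤l i , ≗⇒≤ (l≡0 i)) , ≤-trans (≗⇒≤ (·-zeroʳ k*)) (Σ-nonNeg 0≤l)
  where
  0≤l = λ i → ≗⇒≤ (sym ∘ l≡0 i)

spread-+ : ∀ {m k* E F} {l l′ l″ : Fin m → ℝ} → (∀ i n → seq (l i + l′ i) n ≡ seq (l″ i) n) →
  Spread k* l E → Spread k* l′ F → Spread k* l″ (E + F)
spread-+ {k* = k*} {E} {F} {l} {l′} eq (p , ΣE) (q , ΣF) =
  (λ i → ≤-trans (+-nonNeg (proj₁ (p i)) (proj₁ (q i))) (≗⇒≤ (eq i)) ,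
         ≤-trans (≗⇒≤ (sym ∘ eq i)) (+-mono-≤ (proj₂ (p i)) (proj₂ (q i)))) ,
  ≤-trans (≗⇒≤ (·-distribˡ-+ k* E F))
    (≤-trans (+-mono-≤ ΣE ΣF) (≤-trans (≗⇒≤ (Σ-+ l l′)) (Σ-mono-≤ (≗⇒≤ ∘ eq))))

-- Effect of one arrival on frequencies and losses

module _ {m : ℕ} (u : WeightedItem m) where

  frequency-hit : ∀ σ → frequency (u ∷ σ) (item u) ≡ weight u + frequency σ (item u)
  frequency-hit σ = cong (sum ∘ map weight) (filter-accept (λ v → item v ≟ᶠ item u) refl)

  frequency-miss : ∀ σ {i} → i ≢ item u → frequency (u ∷ σ) i ≡ frequency σ i
  frequency-miss σ {i} i≢u = cong (sum ∘ map weight) (filter-reject (λ v → item v ≟ᶠ i) (i≢u ∘ sym))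

  frequency-∷ : ∀ σ i n → seq (frequency (u ∷ σ) i) n ≡ seq (frequency (u ∷ []) i + frequency σ i) n
  frequency-∷ σ i n with i ≟ᶠ item u
  ... | yes refl rewrite frequency-hit σ | frequency-hit [] =
    cong (ℚ._+ seq (frequency σ i) n) (sym (ℚₚ.+-identityʳ (seq (weight u) n)))
  ... | no i≢u rewrite frequency-miss σ i≢u | frequency-miss [] i≢u =
    sym (ℚₚ.+-identityˡ (seq (frequency σ i) n))

  -- The estimate in the intermediate state `s′` telescopes.
  loss-∷ : ∀ (s s′ s″ : State m) σ i n →
    seq (loss s (u ∷ []) s′ i + loss s′ σ s″ i) n ≡ seq (loss s (u ∷ σ) s″ i) n
  loss-∷ s s′ s″ σ i n = ≡-trans
    (solve 5 (λ a f b g c → (a :+ f :- b) :+ (b :+ g :- c) := a :+ (f :+ g) :- c) refl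
      (seq (estimate s i) n) (seq (frequency (u ∷ []) i) n) (seq (estimate s′ i) n)
      (seq (frequency σ i) n) (seq (estimate s″ i) n))
    (cong (λ z → seq (estimate s i) n ℚ.+ z ℚ.- seq (estimate s″ i) n) (sym (frequency-∷ σ i n)))

-- Estimates after an assignment, and nonnegativity

estimate-hit : ∀ {m} (s : State m) i x → estimate (s [ i ]≔ just x) i ≡ x
estimate-hit s i x = cong (fromMaybe 0ℝ) (lookup∘update i s (just x))

estimate-miss : ∀ {m} (s : State m) {i j} → i ≢ j → ∀ x → estimate (s [ j ]≔ x) i ≡ estimate s i
estimate-miss s i≢j x = cong (fromMaybe 0ℝ) (lookup∘update′ i≢j s x)

update-nonNeg : ∀ {m} (s : State m) i {x} → NonNeg s → 0ℝ ≤ x → NonNeg (s [ i ]≔ just x)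
update-nonNeg s i {x} 0≤s 0≤x j with j ≟ᶠ i
... | yes refl rewrite estimate-hit s i x = 0≤x
... | no j≢i rewrite estimate-miss s j≢i (just x) = 0≤s j

counters-nonNeg : ∀ {m} (s : State m) → NonNeg s → All (0ℝ ≤_) (counters s)
counters-nonNeg []            0≤s = []
counters-nonNeg (nothing ∷ s) 0≤s = counters-nonNeg s (0≤s ∘ suc)
counters-nonNeg (just x ∷ s)  0≤s = 0≤s zero ∷ counters-nonNeg s (0≤s ∘ suc)

IsLargest-nonNeg : ∀ {r xs c} → All (0ℝ ≤_) xs → IsLargest r xs c → 0ℝ ≤ c
IsLargest-nonNeg 0≤xs (ys , (ys↭xs , _) , p , _ , _ , y≤c) =
  ≤-trans (All.lookup (All-resp-↭ (↭-sym ys↭xs) 0≤xs) (∈-lookup p)) y≤c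

-- A single call of `DecrementCounters`

counter-drop : Maybe ℝ → Maybe ℝ → ℝ
counter-drop a b = fromMaybe 0ℝ a - fromMaybe 0ℝ b

x-0≗x : ∀ x n → seq (x - 0ℝ) n ≡ seq x n
x-0≗x x n = ℚₚ.+-identityʳ (seq x n)

x-[x-c]≗c : ∀ x c n → seq (x - (x - c)) n ≡ seq c n
x-[x-c]≗c x c n = solve 2 (λ a b → a :- (a :- b) := b) refl (seq x n) (seq c n)

decrement-result-nonNeg : ∀ {c a b} → DecrementCounter c a b → 0ℝ ≤ fromMaybe 0ℝ b
decrement-result-nonNeg absent     = ≤-refl
decrement-result-nonNeg (remove _) = ≤-refl
decrement-result-nonNeg (keep x≰c) = ≰0⇒≥0 x≰c

still-absent : ∀ {c a b} → a ≡ nothing → DecrementCounter c a b → b ≡ nothing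
still-absent refl absent = refl

-- An absent item drops by 0, a removed counter by its whole value, which is at most `c`, and a kept
-- one by exactly `c`.
decrement-bounds : ∀ {c a b} → 0ℝ ≤ c → 0ℝ ≤ fromMaybe 0ℝ a → DecrementCounter c a b →
  0ℝ ≤ counter-drop a b × counter-drop a b ≤ c
decrement-bounds 0≤c 0≤a absent = ≗⇒≤ (λ _ → refl) , ≤-trans (≗⇒≤ λ _ → refl) 0≤c
decrement-bounds 0≤c 0≤a (remove {x} x≤c) =
  ≤-trans 0≤a (≗⇒≤ (sym ∘ x-0≗x x)) , ≤-trans (≗⇒≤ (x-0≗x x)) (x-y≤0⇒x≤y x≤c)
decrement-bounds {c} 0≤c 0≤a (keep {x} _) =
  ≤-trans 0≤c (≗⇒≤ (sym ∘ x-[x-c]≗c x c)) , ≗⇒≤ (x-[x-c]≗c x c)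

-- A removed counter drops by all of `x`, and a kept one by exactly `c`.
decrement-full : ∀ {c x b} → DecrementCounter c (just x) b → c ≤ x → c ≤ counter-drop (just x) b
decrement-full {x = x} (remove _) c≤x = ≤-trans c≤x (≗⇒≤ (sym ∘ x-0≗x x))
decrement-full {c} {x} (keep _)   c≤x = ≗⇒≤ (sym ∘ x-[x-c]≗c x c)

-- Bridges the list `counters s`, which skips absent items, and the sum over the universe: `ls`
-- lists the drops of the tracked items, and absent items add 0.
drops-at-counters : ∀ {m c} {s s′ : State m} → 0ℝ ≤ c → NonNeg s → Vecᴾ.Pointwise (DecrementCounter c) s s′ →
  ∃[ ls ] (List.Pointwise (λ x l → 0ℝ ≤ l × (c ≤ x → c ≤ l)) (counters s) ls ×
           sum ls ≤ Σ (λ i → estimate s i - estimate s′ i))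
drops-at-counters 0≤c 0≤s [] = [] , [] , ≤-refl
drops-at-counters {s = nothing ∷ _} 0≤c 0≤s (absent ∷ ds) =
  let ls , ps , h = drops-at-counters 0≤c (0≤s ∘ suc) ds
  in ls , ps , ≤-trans (≗⇒≤ λ n → sym (ℚₚ.+-identityˡ (seq (sum ls) n))) (+-mono-≤ (≗⇒≤ {0ℝ} {0ℝ - 0ℝ} λ _ → refl) h)
drops-at-counters {s = just _ ∷ _} 0≤c 0≤s (d ∷ ds) =
  let _ , ps , h = drops-at-counters 0≤c (0≤s ∘ suc) ds
  in _ , (proj₁ (decrement-bounds 0≤c (0≤s zero) d) , decrement-full d) ∷ ps , +-mono-≤ ≤-refl h

-- The `k*` top-ranked counters are at least `c`, so each of them drops by at least `c`. The drops
-- are first rearranged into the order of the ranking, which preserves their sum.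
decrement-total : ∀ {m k* c} {s s′ : State m} → 0ℝ ≤ c → NonNeg s → DecrementCounters k* s c s′ →
  k* · c ≤ Σ (λ i → estimate s i - estimate s′ i)
decrement-total 0≤c 0≤s ((ys , (ys↭xs , sorted) , p , refl , c≤y , _) , ds) =
  let _ , ps , h  = drops-at-counters 0≤c 0≤s ds
      _ , qs , ↭ls = pointwise-↭ (↭-sym ys↭xs) ps
  in ≤-trans (multiple-of-rank≤sum sorted p c≤y qs) (≤-trans (sum-↭ ↭ls) h)

estimate-absent : ∀ {m} (s : State m) {i} → Vec.lookup s i ≡ nothing → estimate s i ≡ 0ℝ
estimate-absent s eq = cong (fromMaybe 0ℝ) eq

-- t is the state after the arriving item has been inserted into, or left out of, s′.
decrement-spread : ∀ {m k* c} {s s′ t : State m} (u : WeightedItem m) → NonNeg s →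
  DecrementCounters k* s c s′ → 0ℝ ≤ c → Vec.lookup s (item u) ≡ nothing →
  (∀ {i} → i ≢ item u → estimate t i ≡ estimate s′ i) →
  0ℝ ≤ weight u - estimate t (item u) → weight u - estimate t (item u) ≤ c →
  Spread k* (loss s (u ∷ []) t) c
decrement-spread {k* = k*} {c} {s} {s′} {t} u 0≤s dec@(_ , ds) 0≤c absent-u same 0≤new new≤c =
  bounds , ≤-trans (decrement-total 0≤c 0≤s dec) (Σ-mono-≤ drop≤loss)
  where
  l = loss s (u ∷ []) t
  hit : ∀ n → seq (l (item u)) n ≡ seq (weight u - estimate t (item u)) n
  hit n rewrite frequency-hit u [] | estimate-absent s absent-u =
    solve 2 (λ w e → con 0ℚ :+ (w :+ con 0ℚ) :- e := w :- e) refl (seq (weight u) n) (seq (estimate t (item u)) n)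
  miss : ∀ {i} → i ≢ item u → ∀ n → seq (l i) n ≡ seq (estimate s i - estimate s′ i) n
  miss {i} i≢u n rewrite frequency-miss u [] i≢u | same i≢u =
    cong (ℚ._- seq (estimate s′ i) n) (ℚₚ.+-identityʳ (seq (estimate s i) n))
  bounds : ∀ i → 0ℝ ≤ l i × l i ≤ c
  bounds i with i ≟ᶠ item u
  ... | yes refl = ≤-trans 0≤new (≗⇒≤ (sym ∘ hit)) , ≤-trans (≗⇒≤ hit) new≤c
  ... | no i≢u =
    let lower , upper = decrement-bounds 0≤c (0≤s i) (Vecᴾ.lookup ds i)
    in ≤-trans lower (≗⇒≤ (sym ∘ miss i≢u)) , ≤-trans (≗⇒≤ (miss i≢u)) upper
  no-drop : ∀ n → seq (estimate s (item u) - estimate s′ (item u)) n ≡ 0ℚ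
  no-drop n rewrite still-absent absent-u (Vecᴾ.lookup ds (item u)) | absent-u = refl
  -- The drops of the call alone reach the required total. The arriving item has drop 0 and a
  -- nonnegative loss; for every other item, drop and loss agree.
  drop≤loss : ∀ i → estimate s i - estimate s′ i ≤ l i
  drop≤loss i with i ≟ᶠ item u
  ... | yes refl = ≤-trans (≗⇒≤ no-drop) (proj₁ (bounds i))
  ... | no i≢u = ≗⇒≤ (sym ∘ miss i≢u)

-- Updates and runs

-- Only a call of `DecrementCounters` creates error, so `c` is 0 for the first two kinds of update
-- and the subtracted value for the other two. Nonnegative estimates are carried along because they
-- make that value nonnegative.
update-spread : ∀ {m k k*} {s s′ : State m} {u} → NonNeg s → Update k k* s u s′ →
  NonNeg s′ × ∃[ c ] Spread k* (loss s (u ∷ []) s′) c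
update-spread {s = s} {u = u} 0≤s (increment {x} present) =
  update-nonNeg s (item u) 0≤s (+-nonNeg (subst (0ℝ ≤_) (cong (fromMaybe 0ℝ) present) (0≤s (item u))) (<⇒≤ (positive u))) ,
  0ℝ , spread-zero lossless
  where
  lossless : ∀ i n → seq (loss s (u ∷ []) (s [ item u ]≔ just (x + weight u)) i) n ≡ 0ℚ
  lossless i n with i ≟ᶠ item u
  ... | yes refl rewrite frequency-hit u [] | estimate-hit s i (x + weight u) | present =
    solve 2 (λ a w → a :+ (w :+ con 0ℚ) :- (a :+ w) := con 0ℚ) refl (seq x n) (seq (weight u) n)
  ... | no i≢u rewrite frequency-miss u [] i≢u | estimate-miss s i≢u (just (x + weight u)) =
    solve 1 (λ a → a :+ con 0ℚ :- a := con 0ℚ) refl (seq (estimate s i) n)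
update-spread {s = s} {u = u} 0≤s (insert absent-u _) =
  update-nonNeg s (item u) 0≤s (<⇒≤ (positive u)) , 0ℝ , spread-zero lossless
  where
  lossless : ∀ i n → seq (loss s (u ∷ []) (s [ item u ]≔ just (weight u)) i) n ≡ 0ℚ
  lossless i n with i ≟ᶠ item u
  ... | yes refl rewrite frequency-hit u [] | estimate-hit s i (weight u) | absent-u =
    solve 1 (λ w → con 0ℚ :+ (w :+ con 0ℚ) :- w := con 0ℚ) refl (seq (weight u) n)
  ... | no i≢u rewrite frequency-miss u [] i≢u | estimate-miss s i≢u (just (weight u)) =
    solve 1 (λ a → a :+ con 0ℚ :- a := con 0ℚ) refl (seq (estimate s i) n)
update-spread {s = s} {u = u} 0≤s (decrement-insert {c} {s′} absent-u _ dec c≤w) =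
  update-nonNeg s′ (item u) (λ i → decrement-result-nonNeg (Vecᴾ.lookup (proj₂ dec) i)) (x≤y⇒0≤y-x c≤w) ,
  c , decrement-spread {t = s′ [ item u ]≔ just (weight u - c)} u 0≤s dec 0≤c absent-u (λ i≢u → estimate-miss s′ i≢u _)
        -- The inserted item keeps `weight u - c`, so its loss is exactly `c`.
        (≤-trans 0≤c (≗⇒≤ (sym ∘ new))) (≗⇒≤ new)
  where
  0≤c = IsLargest-nonNeg (counters-nonNeg s 0≤s) (proj₁ dec)
  new : ∀ n → seq (weight u - estimate (s′ [ item u ]≔ just (weight u - c)) (item u)) n ≡ seq c n
  new n rewrite estimate-hit s′ (item u) (weight u - c) = x-[x-c]≗c (weight u) c n
update-spread {s = s} {u = u} 0≤s (decrement-discard {c} {s′} absent-u _ dec c≰w) =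
  (λ i → decrement-result-nonNeg (Vecᴾ.lookup (proj₂ dec) i)) ,
  c , decrement-spread {t = s′} u 0≤s dec 0≤c absent-u (λ _ → refl)
        -- The discarded item loses its whole weight, which is positive and, by `c≰w`, at most `c`.
        (≤-trans (<⇒≤ (positive u)) (≗⇒≤ (sym ∘ new))) (≤-trans (≗⇒≤ new) (≰⇒≥ c≰w))
  where
  0≤c = IsLargest-nonNeg (counters-nonNeg s 0≤s) (proj₁ dec)
  new : ∀ n → seq (weight u - estimate s′ (item u)) n ≡ seq (weight u) n
  new n rewrite still-absent absent-u (Vecᴾ.lookup (proj₂ dec) (item u)) = x-0≗x (weight u) n

run-spread : ∀ {m k k*} {s s′ : State m} {σ} → NonNeg s → Run k k* s σ s′ →
  NonNeg s′ × ∃[ E ] Spread k* (loss s σ s′) E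
run-spread {s = s} 0≤s [] = 0≤s , 0ℝ , spread-zero λ i n →
  solve 1 (λ a → a :+ con 0ℚ :- a := con 0ℚ) refl (seq (estimate s i) n)
run-spread {s = s} {s″} 0≤s (_∷_ {s′ = s′} {u = u} {σ = σ} up run) =
  let 0≤s′ , c , spread-u = update-spread 0≤s up
      0≤s″ , E , spread-σ = run-spread 0≤s′ run
  in 0≤s″ , c + E , spread-+ (loss-∷ u s s′ s″ σ) spread-u spread-σ

-- From the invariant to the residual bound

estimate-initial : ∀ {m} (i : Fin m) → estimate initial i ≡ 0ℝ
estimate-initial i = cong (fromMaybe 0ℝ) (lookup-replicate i nothing)

theorem5 : ∀ (m k k* : ℕ) → 1 ≤ᴺ k → 1 ≤ᴺ k* → k* ≤ᴺ k →
    (σ : Stream m) (s : State m) → Run k k* initial σ s →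
    (j : ℕ) (j<k* : j <ᴺ k*) (i : Fin m) (R : ℝ) → IsResidual σ j R →
    (0ℝ ≤ frequency σ i - estimate s i) × (frequency σ i - estimate s i ≤ (R / (k* ∸ j)) {{>-nonZero (m<n⇒0<n∸m j<k*)}})
theorem5 m k k* _ _ _ σ s run j j<k* i R (fs , (fs↭ , _) , _ , res≤R)
  with run-spread (λ i → subst (0ℝ ≤_) (sym (estimate-initial i)) ≤-refl) run
... | 0≤s , E , bounds , total =
  ≤-trans (proj₁ (bounds i)) (≗⇒≤ (loss≗error i)) ,
  ≤-trans (≗⇒≤ (sym ∘ loss≗error i)) (≤-trans (proj₂ (bounds i)) E≤R/)
  where
  loss≗error : ∀ i n → seq (loss initial σ s i) n ≡ seq (frequency σ i - estimate s i) n
  loss≗error i n rewrite estimate-initial i =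
    cong (ℚ._- seq (estimate s i) n) (ℚₚ.+-identityˡ (seq (frequency σ i) n))
  -- This holds because the final estimate is nonnegative.
  loss≤frequency : ∀ i → loss initial σ s i ≤ frequency σ i
  loss≤frequency i = ≤-trans (≗⇒≤ (loss≗error i)) (0≤x-y⇒y≤x {frequency σ i} {frequency σ i - estimate s i} (≤-trans (0≤s i)
    (≗⇒≤ λ n → solve 2 (λ f e → e := f :- (f :- e)) refl (seq (frequency σ i) n) (seq (estimate s i) n))))
  0≤E : 0ℝ ≤ E
  -- The loss of the given item `i` lies between 0 and `E`.
  0≤E = ≤-trans (proj₁ (bounds i)) (proj₂ (bounds i))
  E≤R/ : E ≤ (R / (k* ∸ j)) {{>-nonZero (m<n⇒0<n∸m j<k*)}}
  E≤R/ =
    -- The losses are listed in the order of `fs`, so that the `j` most frequent items are charged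
    -- `E` each and all others their frequencies.
    let es , ps , es↭ = pointwise-↭ (↭-sym fs↭) (pointwise-tabulate (λ i → loss≤frequency i , proj₂ (bounds i)))
        total≤ = ≤-trans (≤-trans total (sum-↭ (↭-sym es↭)))
          (≤-trans (sum≤multiple+sum-drop 0≤E j ps) (+-mono-≤ (≤-refl {j · E}) res≤R))
    -- From `k* · E ≤ j · E + R`, the `j` copies of `E` cancel, and dividing by `k* ∸ j` leaves the
    -- bound.
    in ·-≤⇒≤-/ (k* ∸ j) {{>-nonZero (m<n⇒0<n∸m j<k*)}} (·-cancel-≤ (ℕₚ.<⇒≤ j<k*) total≤)
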